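{- Let $\mathcal{R}$ be any complete representation. Every regular $\textsf{MRes- }\mathcal{R}$ refutation of $\textsf{CR}_n$ has size $2^{\Omega(n)}$.
   Context: The completion formulas: $\textsf{CR}_n = \exists \{x_{ij}\}_{i,j\in[n]}\ \forall z\ \exists \{a_i\}_{i\in[n]}\ \exists\{b_j\}_{j\in[n]}.\ \big(\bigwedge_{i,j\in[n]}(A_{ij}\wedge B_{ij})\big)\wedge L_A\wedge L_B$, where $A_{ij}=x_{ij}\vee z\vee a_i$, $B_{ij}=\overline{x_{ij}}\vee\bar z\vee b_j$, $L_A=\overline{a_1}\vee\dots\vee\overline{a_n}$, $L_B=\overline{b_1}\vee\dots\vee\overline{b_n}$. General setting: for a QBF $\Phi=Q.\phi$ in closed prenex CNF with existential variables $X$ and universal $U$, $y<_Q x$ means $y$ is in an earlier block, $L_Q(u)$ = existential variables left of $u$. Falsifying $u$-literal of $C\in\phi$: $0$ if $u\in C$, $1$ if $\bar u\in C$, $\ast$ otherwise; existential subclause = existential literals of $C$. A strategy for $u$ is a function from assignments of $L_Q(u)$ to $\{0,1,\ast\}$. $p\simeq q$ for $p,q\in\{0,1,\ast\}$ if $p=\ast$, $q=\ast$ or $p=q$; strategies consistent if pointwise consistent; $H\circ H'$ (for consistent $H,H'$) takes $H(\varepsilon)$ if $\ne\ast$ else $H'(\varepsilon)$; $H\overset{x}{\bowtie}H'$ is $H$ on $x=1$ and $H'$ on $x=0$. A representation is complete if every finite function has at least one representation in it. For a complete $\mathcal{R}$, an $\textsf{MRes- }\mathcal{R}$ derivation is a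 sequence of lines $(C_i,\{H^u_i:u\in U\})$, $C_i$ a clause of existential literals, $H^u_i$ strategies given in $\mathcal{R}$, each line either an axiom ($C_i$ the existential subclause of some $C\in\phi$, $H^u_i$ constant equal to the falsifying $u$-literal of $C$) or a resolution step ($a,b<i$, existential pivot $x$, $C_i=res(C_a,C_b,x)$ where $res(C\vee x,D\vee\bar x,x)=C\vee D$, and for each $u$: $H^u_i=H^u_b\overset{x}{\bowtie}H^u_a$ if $x<_Q u$; $H^u_a\simeq H^u_b$ and $H^u_i=H^u_a\circ H^u_b$ if $u<_Q x$). A refutation ends with the empty clause; its size is its number of lines. The derivation graph $G_\pi$ has lines as nodes and edges from hypotheses to resolvents. A refutation is regular if no leaf-to-root path in $G_\pi$ uses any existential variable as pivot more than once. -}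

module Defs where

open import Data.Nat using (ℕ; zero; suc; _<_; _<?_)
open import Data.Bool using (Bool; true; false; if_then_else_)
open import Data.Fin as Fin using (Fin; fromℕ)
open import Data.List using (List; []; _∷_; _++_; map; concatMap; filter; length; allFin)
open import Data.List.Membership.Propositional using (_∈_)
open import Data.List.Relation.Unary.Any using (index)
open import Data.List.Relation.Unary.Unique.Propositional using (Unique)
open import Data.Product using (Σ; ∃; _×_; _,_; proj₁)
open import Data.Product.Properties using (≡-dec)
open import Data.Sum using (_⊎_)
open import Data.Bool.Properties using () renaming (_≟_ to _≟B_)
open import Relation.Nullary using (Dec; yes; no; ¬_)
open import Relation.Nullary.Decidable using (_×-dec_)
open import Relation.Binary.PropositionalEquality using (_≡_; _≢_; refl)
open import Relation.Binary.Definitions using (DecidableEquality)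
open import Function.Bundles using (_⇔_)

data Val : Set where
  v0 v1 ⋆ : Val

_≃_ : Val → Val → Set
p ≃ q = (p ≡ ⋆) ⊎ (q ≡ ⋆) ⊎ (p ≡ q)

_⊙_ : Val → Val → Val
⋆  ⊙ q = q
v0 ⊙ q = v0
v1 ⊙ q = v1

record Representation : Set₁ where
  field
    Obj  : ℕ → Set
    ⟦_⟧  : ∀ {k} → Obj k → (Fin k → Bool) → Val

Complete : Representation → Set
Complete R = ∀ k (f : (Fin k → Bool) → Val) →
  ∃ λ (o : Obj k) → ∀ ε → ⟦ o ⟧ ε ≡ f ε
  where open Representation R

data Quant : Set where
  ∃q ∀q : Quant

_≟Q_ : DecidableEquality Quant
∃q ≟Q ∃q = yes refl
∃q ≟Q ∀q = no λ ()
∀q ≟Q ∃q = no λ ()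
∀q ≟Q ∀q = yes refl

record QBF : Set₁ where
  field
    Var    : Set
    _≟V_   : DecidableEquality Var
    vars   : List Var          -- enumeration of all variables (each once)
    quant  : Var → Quant
    level  : Var → ℕ           -- index of its quantifier block; y <_Q x iff level y < level x
    matrix : List (List (Var × Bool))   -- CNF; literal (v , true) = v, (v , false) = ¬v

module MRes (Φ : QBF) (R : Representation) where
  open QBF Φ
  open Representation R

  Lit : Set
  Lit = Var × Bool

  Clause : Set
  Clause = List Lit

  _≟L_ : DecidableEquality Lit
  _≟L_ = ≡-dec _≟V_ _≟B_

  -- clauses are sets: equality up to membership
  _≋_ : Clause → Clause → Set
  C ≋ D = ∀ l → (l ∈ C) ⇔ (l ∈ D)

  IsExist IsUniv : Var → Set
  IsExist v = quant v ≡ ∃q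
  IsUniv  v = quant v ≡ ∀q

  _<Q_ : Var → Var → Set
  y <Q x = level y < level x

  exSub : Clause → Clause
  exSub C = filter (λ l → quant (proj₁ l) ≟Q ∃q) C

  _∈?_ : (l : Lit) (C : Clause) → Dec (l ∈ C)
  l ∈? [] = no λ ()
  l ∈? (m ∷ C) with l ≟L m | l ∈? C
  ... | yes refl | _     = yes (Data.List.Relation.Unary.Any.here refl)
  ... | no _     | yes p = yes (Data.List.Relation.Unary.Any.there p)
  ... | no ne    | no np = no λ { (Data.List.Relation.Unary.Any.here e) → ne e
                                ; (Data.List.Relation.Unary.Any.there p) → np p }

  falsLit : Var → Clause → Val
  falsLit u C with (u , true) ∈? C | (u , false) ∈? C
  ... | yes _ | _     = v0
  ... | no _  | yes _ = v1
  ... | no _  | no _  = ⋆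

  Lft : Var → List Var
  Lft u = filter (λ y → (quant y ≟Q ∃q) ×-dec (level y <? level u)) vars

  Assign : Var → Set
  Assign u = Fin (length (Lft u)) → Bool

  Strategy : Var → Set
  Strategy u = Obj (length (Lft u))

  record Line : Set where
    field
      clause : Clause                               -- existential literals only
      strat  : (u : Var) → IsUniv u → Strategy u
  open Line public

  IsResolvent : Clause → Clause → Clause → Var → Set
  IsResolvent Ci Ca Cb x = ∀ l → (l ∈ Ci) ⇔
    (((l ∈ Ca) × (l ≢ (x , true))) ⊎ ((l ∈ Cb) × (l ≢ (x , false))))

  ValidAxiom : Line → Set
  ValidAxiom L = Σ Clause λ C → (C ∈ matrix) × (clause L ≋ exSub C) ×
    (∀ u (pu : IsUniv u) (ε : Assign u) → ⟦ strat L u pu ⟧ ε ≡ falsLit u C)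

  ValidRes : (Li La Lb : Line) → Var → Set
  ValidRes Li La Lb x =
    IsExist x × ((x , true) ∈ clause La) × ((x , false) ∈ clause Lb) ×
    IsResolvent (clause Li) (clause La) (clause Lb) x ×
    (∀ u (pu : IsUniv u) →
      ((p : x ∈ Lft u) → (ε : Assign u) →
         ⟦ strat Li u pu ⟧ ε ≡
           (if ε (index p) then ⟦ strat Lb u pu ⟧ ε else ⟦ strat La u pu ⟧ ε))
      ×
      (u <Q x → ((ε : Assign u) → ⟦ strat La u pu ⟧ ε ≃ ⟦ strat Lb u pu ⟧ ε) ×
                ((ε : Assign u) → ⟦ strat Li u pu ⟧ ε ≡ (⟦ strat La u pu ⟧ ε ⊙ ⟦ strat Lb u pu ⟧ ε))))

  data Kind (s : ℕ) : Set where
    ax : Kind s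
    rs : (a b : Fin s) (x : Var) → Kind s

  Valid : ∀ {s} → (Fin s → Line) → Fin s → Kind s → Set
  Valid line i ax         = ValidAxiom (line i)
  Valid line i (rs a b x) = (a Fin.< i) × (b Fin.< i) × ValidRes (line i) (line a) (line b) x

  record Derivation : Set where
    field
      len   : ℕ
      line  : Fin (suc len) → Line
      kind  : Fin (suc len) → Kind (suc len)
      valid : ∀ i → Valid line i (kind i)

    size : ℕ
    size = suc len

    root : Fin (suc len)
    root = fromℕ len

  open Derivation public

  record Refutation : Set where
    field
      deriv : Derivation
      empty : clause (line deriv (root deriv)) ≡ []
  open Refutation public

  data PathTo (π : Derivation) : Fin (size π) → List Var → Set where
    leaf : ∀ {i} → kind π i ≡ ax → PathTo π i []
    viaL : ∀ {i a b x ps} → kind π i ≡ rs a b x → PathTo π a ps → PathTo π i (x ∷ ps)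
    viaR : ∀ {i a b x ps} → kind π i ≡ rs a b x → PathTo π b ps → PathTo π i (x ∷ ps)

  Regular : Refutation → Set
  Regular ρ = ∀ ps → PathTo (deriv ρ) (root (deriv ρ)) ps → Unique ps

  refSize : Refutation → ℕ
  refSize ρ = size (deriv ρ)

data CRVar (n : ℕ) : Set where
  x : Fin n → Fin n → CRVar n
  z : CRVar n
  a : Fin n → CRVar n
  b : Fin n → CRVar n

_≟CR_ : ∀ {n} → DecidableEquality (CRVar n)
x i j ≟CR x k l with i Fin.≟ k | j Fin.≟ l
... | yes refl | yes refl = yes refl
... | no ne    | _        = no λ { refl → ne refl }
... | yes _    | no ne    = no λ { refl → ne refl }
x _ _ ≟CR z   = no λ ()
x _ _ ≟CR a _ = no λ ()
x _ _ ≟CR b _ = no λ ()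
z ≟CR x _ _   = no λ ()
z ≟CR z       = yes refl
z ≟CR a _     = no λ ()
z ≟CR b _     = no λ ()
a _ ≟CR x _ _ = no λ ()
a _ ≟CR z     = no λ ()
a i ≟CR a k with i Fin.≟ k
... | yes refl = yes refl
... | no ne    = no λ { refl → ne refl }
a _ ≟CR b _   = no λ ()
b _ ≟CR x _ _ = no λ ()
b _ ≟CR z     = no λ ()
b _ ≟CR a _   = no λ ()
b i ≟CR b k with i Fin.≟ k
... | yes refl = yes refl
... | no ne    = no λ { refl → ne refl }

crQuant : ∀ {n} → CRVar n → Quant
crQuant z = ∀q
crQuant _ = ∃q

crLevel : ∀ {n} → CRVar n → ℕ
crLevel (x _ _) = 0
crLevel z       = 1
crLevel (a _)   = 2
crLevel (b _)   = 2

crVars : (n : ℕ) → List (CRVar n)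
crVars n = concatMap (λ i → map (x i) (allFin n)) (allFin n)
        ++ z ∷ map a (allFin n) ++ map b (allFin n)

A-clause B-clause : ∀ {n} → Fin n → Fin n → List (CRVar n × Bool)
A-clause i j = (x i j , true)  ∷ (z , true)  ∷ (a i , true) ∷ []
B-clause i j = (x i j , false) ∷ (z , false) ∷ (b j , true) ∷ []

LA-clause LB-clause : (n : ℕ) → List (CRVar n × Bool)
LA-clause n = map (λ i → (a i , false)) (allFin n)
LB-clause n = map (λ j → (b j , false)) (allFin n)

crMatrix : (n : ℕ) → List (List (CRVar n × Bool))
crMatrix n =
  concatMap (λ i → concatMap (λ j → A-clause i j ∷ B-clause i j ∷ []) (allFin n)) (allFin n)
  ++ LA-clause n ∷ LB-clause n ∷ []

CR : ℕ → QBF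
CR n = record
  { Var    = CRVar n
  ; _≟V_   = _≟CR_
  ; vars   = crVars n
  ; quant  = crQuant
  ; level  = crLevel
  ; matrix = crMatrix n
  }

{-# OPTIONS --safe #-}
module Submission where

-- In a regular refutation a pivot aₖ has no L_A below its left premise, and
-- aᵢ ∈ C_left forces that no A_ij lies below the right premise R.  The merge
-- functions of the two premises therefore depend on disjoint sets of rows of x.
-- They agree pointwise, since only L_A and L_B themselves carry ⋆, unless
-- R = L_A; so they are constantly 0, and below them lie no B_ij and hence no
-- x-pivots.  The same holds for bₖ with columns and the constant 1.  Following
-- an assignment of x down from the root, the first pivot that is no x-variable
-- thus belongs to a line containing n falsified literals, one positive in each
-- row or one negative in each column.
--
-- For x_ij = [σᵢ = τⱼ] with σ, τ ∈ {0,1}ⁿ, the line reached determines σ from τ in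
-- the row case and τ from σ in the column case.  Hence 4ⁿ ≤ size · 2ⁿ.

open import Defs
open import Data.Bool using (Bool; true; false; not; if_then_else_)
open import Data.Bool.Properties using (not-¬)
open import Data.Empty using (⊥)
open import Data.Fin as Fin using (Fin; zero; suc; combine; remQuot; finToFun)
open import Data.Fin.Induction using (<-wellFounded)
open import Data.Fin.Properties using (combine-remQuot; combine-injective; injective⇒≤)
open import Data.List using (List; []; _∷_; allFin; concatMap; lookup)
open import Data.List.Membership.Propositional using (_∈_; _∉_; lose; find)
open import Data.List.Membership.Propositional.Properties
open import Data.List.Relation.Unary.All as All using ()
open import Data.List.Relation.Unary.AllPairs as AllPairs using (_∷_)
open import Data.List.Relation.Unary.Any using (here; there)
open import Data.List.Relation.Unary.Any.Properties using (lookup-index)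
open import Data.List.Relation.Unary.Unique.Propositional using (Unique)
open import Data.Nat using (ℕ; zero; suc; _≤_; _*_; _^_; _/_; z≤n; s≤s)
open import Data.Nat.DivMod using (n/1≡n)
open import Data.Nat.Properties using (*-cancelʳ-≤; m^n≢0)
open import Data.Product as Product using (∃-syntax; ∃; _×_; _,_; proj₁; proj₂; uncurry)
open import Data.Sum as Sum using (_⊎_; inj₁; inj₂)
open import Data.Unit using (⊤; tt)
open import Function using (_∘_; Injective)
open import Function.Bundles using (Equivalence)
open import Induction.WellFounded using (Acc; acc)
open import Relation.Nullary using (yes; no; ¬_)
open import Relation.Nullary.Decidable using (does; dec-true; dec-false)
open import Relation.Nullary.Negation using (contradiction)
open import Relation.Binary.PropositionalEquality

-- Literals of the two symmetric sides

-- The side true stands for the aᵢ and L_A, the side false for the bⱼ and L_B.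
-- In x-var s i j the index i is the one shared with y-var s i, so x-var false
-- is transposed.
x-var : ∀ {n} → Bool → Fin n → Fin n → CRVar n
x-var true  i j = x i j
x-var false i j = x j i

y-var : ∀ {n} → Bool → Fin n → CRVar n
y-var true  = a
y-var false = b

xlit : ∀ {n} → Bool → Fin n → Fin n → CRVar n × Bool
xlit s i j = x-var s i j , s

ylit nlit : ∀ {n} → Bool → Fin n → CRVar n × Bool
ylit s i = y-var s i , true
nlit s i = y-var s i , false

-- The falsifying `z`-literal of A_ij (side `true`) and of B_ij (side `false`).
val : Bool → Val
val true  = v0
val false = v1

val-injective : ∀ {s t} → val s ≡ val t → s ≡ t
val-injective {true}  {true}  _ = refl
val-injective {false} {false} _ = refl

val≢⋆ : ∀ {s} → val s ≢ ⋆
val≢⋆ {true}  ()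
val≢⋆ {false} ()

xlit-injective : ∀ {n s t} {i j k l : Fin n} → xlit s i j ≡ xlit t k l → s ≡ t × i ≡ k × j ≡ l
xlit-injective {s = true}  {true}  refl = refl , refl , refl
xlit-injective {s = false} {false} refl = refl , refl , refl

xlit≢ylit : ∀ {n s t c} {i j k : Fin n} → (x-var s i j , c) ≢ ylit t k
xlit≢ylit {s = true}  {true}  ()
xlit≢ylit {s = true}  {false} ()
xlit≢ylit {s = false} {true}  ()
xlit≢ylit {s = false} {false} ()

x≢y : ∀ {n s t} {i j k : Fin n} → x-var s i j ≢ y-var t k
x≢y {s = true}  {true}  ()
x≢y {s = true}  {false} ()
x≢y {s = false} {true}  ()
x≢y {s = false} {false} ()

y-var-injective : ∀ {n s t} {i j : Fin n} → y-var s i ≡ y-var t j → s ≡ t × i ≡ j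
y-var-injective {s = true}  {true}  refl = refl , refl
y-var-injective {s = false} {false} refl = refl , refl

data PivotView {n} : CRVar n → Set where
  is-x : ∀ i j → PivotView (x i j)
  is-y : ∀ s k → PivotView (y-var s k)

pivotView : ∀ {n} (v : CRVar n) → crQuant v ≡ ∃q → PivotView v
pivotView (x i j) _ = is-x i j
pivotView (a i)   _ = is-y true i
pivotView (b i)   _ = is-y false i

-- Assignments to the x-variables and the operation `⊙`

Assignment : ℕ → Set
Assignment n = Fin n → Fin n → Bool

-- Transposes in step with `x-var`: `at s α i j` is the value that `α` gives to `x-var s i j`.
at : ∀ {n} → Bool → Assignment n → Assignment n
at true  α i j = α i j
at false α i j = α j i

at-involutive : ∀ {n} s (α : Assignment n) i j → at s (at s α) i j ≡ α i j
at-involutive true  α i j = refl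
at-involutive false α i j = refl

x-var-swap : ∀ {n} s (i j : Fin n) → x-var s i j ≡ x-var (not s) j i
x-var-swap true  i j = refl
x-var-swap false i j = refl

⊙≢⋆ : ∀ {p q} → p ≢ ⋆ → p ⊙ q ≢ ⋆
⊙≢⋆ {⋆} p≢⋆ _ = p≢⋆ refl

⊙-valˡ : ∀ {s p q} → p ≡ val s → p ⊙ q ≡ val s
⊙-valˡ {true}  refl = refl
⊙-valˡ {false} refl = refl

⊙-valʳ : ∀ {s p q} → p ≃ q → q ≡ val s → p ⊙ q ≡ val s
⊙-valʳ         (inj₁ refl)        q≡ = q≡
⊙-valʳ         (inj₂ (inj₁ refl)) q≡ = contradiction (sym q≡) val≢⋆
⊙-valʳ {s}     (inj₂ (inj₂ refl)) q≡ = ⊙-valˡ {s} q≡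

set : ∀ {n} → Fin n → Fin n → Bool → Assignment n → Assignment n
set i j c α k l = if does (x i j ≟CR x k l) then c else α k l

set-same : ∀ {n} (i j : Fin n) c α → set i j c α i j ≡ c
set-same i j c α = cong (if_then c else α i j) (dec-true (x i j ≟CR x i j) refl)

set-other : ∀ {n} (i j k l : Fin n) c α → x k l ≢ x i j → set i j c α k l ≡ α k l
set-other i j k l c α ne = cong (if_then c else α k l) (dec-false (x i j ≟CR x k l) (ne ∘ sym))

-- The clauses of the matrix

long-clause : Bool → (n : ℕ) → List (CRVar n × Bool)
long-clause true  = LA-clause
long-clause false = LB-clause

∈-long⁺ : ∀ {n} s (i : Fin n) → nlit s i ∈ long-clause s n
∈-long⁺ true  i = ∈-map⁺ _ (∈-allFin i)
∈-long⁺ false i = ∈-map⁺ _ (∈-allFin i)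

∈-long⁻ : ∀ {n} s {l} → l ∈ long-clause s n → ∃ λ i → l ≡ nlit s i
∈-long⁻ true  m with i , _ , eq ← ∈-map⁻ _ m = i , eq
∈-long⁻ false m with i , _ , eq ← ∈-map⁻ _ m = i , eq

∈-pair⁻ : ∀ {A : Set} {k l m : A} → k ∈ l ∷ m ∷ [] → k ≡ l ⊎ k ≡ m
∈-pair⁻ (here e)         = inj₁ e
∈-pair⁻ (there (here e)) = inj₂ e

data MatrixView {n} : List (CRVar n × Bool) → Set where
  A-view    : ∀ i j → MatrixView (A-clause i j)
  B-view    : ∀ i j → MatrixView (B-clause i j)
  long-view : ∀ s → MatrixView (long-clause s n)

matrixView : ∀ {n K} → K ∈ crMatrix n → MatrixView K
matrixView {n} m with ∈-++⁻ (concatMap (λ i → concatMap (λ j → A-clause i j ∷ B-clause i j ∷ [])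
                                                          (allFin n)) (allFin n)) m
... | inj₂ (here refl)         = long-view true
... | inj₂ (there (here refl)) = long-view false
... | inj₁ m₁ with find (∈-concatMap⁻ _ {allFin n} m₁)
...   | i , _ , m₂ with find (∈-concatMap⁻ _ {allFin n} m₂)
...     | j , _ , here refl         = A-view i j
...     | j , _ , there (here refl) = B-view i j

x∈crVars : ∀ {n} (i j : Fin n) → x i j ∈ crVars n
x∈crVars i j = ∈-++⁺ˡ (∈-concatMap⁺ _ (lose (∈-allFin i) (∈-map⁺ (x i) (∈-allFin j))))

-- Axioms and resolution steps of a derivation

module Unfolding {n : ℕ} (R : Representation) (π : MRes.Derivation (CR n) R) where
  open MRes (CR n) R
  open Representation R

  Index : Set
  Index = Fin (size π)

  C : Index → Clause
  C p = clause (line π p)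

  -- `Lft z` lists x-variables only; `false` is a default for the others.
  value : Assignment n → CRVar n → Bool
  value α (x i j) = α i j
  value α _       = false

  x∈Lft : ∀ i j → x i j ∈ Lft z
  x∈Lft i j = ∈-filter⁺ _ (x∈crVars i j) (refl , s≤s z≤n)

  environment : Assignment n → Assign z
  environment α k = value α (lookup (Lft z) k)

  h : Index → Assignment n → Val
  h p α = ⟦ strat (line π p) z refl ⟧ (environment α)

  -- The line of an axiom A_ij if `s` is `true`, of B_ji if `s` is `false`.
  record IsShort (s : Bool) (i j : Fin n) (p : Index) : Set where
    field
      only  : ∀ {l} → l ∈ C p → l ≡ xlit s i j ⊎ l ≡ ylit s i
      x∈    : xlit s i j ∈ C p
      y∈    : ylit s i ∈ C p
      h≡val : ∀ α → h p α ≡ val s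

  record IsLong (s : Bool) (p : Index) : Set where
    field
      only : ∀ {l} → l ∈ C p → ∃ λ i → l ≡ nlit s i
      y∈   : ∀ i → nlit s i ∈ C p
      h≡⋆  : ∀ α → h p α ≡ ⋆

  data AxiomView (p : Index) : Set where
    short : ∀ s i j → IsShort s i j p → AxiomView p
    long  : ∀ s → IsLong s p → AxiomView p

  falsLit-⋆ : ∀ u {K} → (∀ c → (u , c) ∉ K) → falsLit u K ≡ ⋆
  falsLit-⋆ u {K} ∉K with (u , true) ∈? K | (u , false) ∈? K
  ... | yes m | _     = contradiction m (∉K true)
  ... | no _  | yes m = contradiction m (∉K false)
  ... | no _  | no _  = refl

  z∉long : ∀ s c → (z , c) ∉ long-clause s n
  z∉long s c m with ∈-long⁻ s m
  z∉long true  c m | _ , ()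
  z∉long false c m | _ , ()

  existential-nlit : ∀ s (i : Fin n) → crQuant (y-var s i) ≡ ∃q
  existential-nlit true  i = refl
  existential-nlit false i = refl

  axiomView : ∀ {p} → ValidAxiom (line π p) → AxiomView p
  axiomView {p} (K , K∈ , C≋ , st) with matrixView K∈
  ... | A-view i j = short true i j record
    { only  = λ m → ∈-pair⁻ (Equivalence.to (C≋ _) m)
    ; x∈    = Equivalence.from (C≋ _) (here refl)
    ; y∈    = Equivalence.from (C≋ _) (there (here refl))
    ; h≡val = λ α → st z refl (environment α) }
  ... | B-view i j = short false j i record
    { only  = λ m → ∈-pair⁻ (Equivalence.to (C≋ _) m)
    ; x∈    = Equivalence.from (C≋ _) (here refl)
    ; y∈    = Equivalence.from (C≋ _) (there (here refl))
    ; h≡val = λ α → st z refl (environment α) }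
  ... | long-view s = long s record
    { only = λ m → ∈-long⁻ s (proj₁ (∈-filter⁻ _ (Equivalence.to (C≋ _) m)))
    ; y∈   = λ i → Equivalence.from (C≋ _) (∈-filter⁺ _ (∈-long⁺ s i) (existential-nlit s i))
    ; h≡⋆  = λ α → trans (st z refl (environment α)) (falsLit-⋆ z (z∉long s)) }

  record Step (p l r : Index) (v : CRVar n) : Set where
    field
      existential : crQuant v ≡ ∃q
      v∈l         : (v , true) ∈ C l
      v̄∈r         : (v , false) ∈ C r
      fromˡ       : ∀ {m} → m ∈ C l → m ≢ (v , true) → m ∈ C p
      fromʳ       : ∀ {m} → m ∈ C r → m ≢ (v , false) → m ∈ C p
      origin      : ∀ {m} → m ∈ C p → m ∈ C l ⊎ m ∈ C r

  valid-node : ∀ {p l r v} → kind π p ≡ rs l r v →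
               l Fin.< p × r Fin.< p × ValidRes (line π p) (line π l) (line π r) v
  valid-node {p} eq = subst (Valid (line π) p) eq (valid π p)

  axiom-at : ∀ {p} → kind π p ≡ ax → AxiomView p
  axiom-at {p} eq = axiomView (subst (Valid (line π) p) eq (valid π p))

  step : ∀ {p l r v} → kind π p ≡ rs l r v → Step p l r v
  step eq with _ , _ , ex , pos , neg , res , _ ← valid-node eq = record
    { existential = ex ; v∈l = pos ; v̄∈r = neg
    ; fromˡ  = λ m ne → Equivalence.from (res _) (inj₁ (m , ne))
    ; fromʳ  = λ m ne → Equivalence.from (res _) (inj₂ (m , ne))
    ; origin = λ m → Sum.map proj₁ proj₁ (Equivalence.to (res _) m) }

  h-x : ∀ {p l r i j} → kind π p ≡ rs l r (x i j) → ∀ α →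
        h p α ≡ (if α i j then h r α else h l α)
  h-x {i = i} {j} eq α with _ , _ , _ , _ , _ , _ , st ← valid-node eq =
    trans (proj₁ (st z refl) (x∈Lft i j) (environment α))
          -- The strategy branches on a position in `Lft z`; `lookup-index` identifies the variable
          -- there as `x i j`.
          (cong (λ w → if value α w then _ else _) (sym (lookup-index (x∈Lft i j))))

  h-xˡ : ∀ {p l r i j α} → kind π p ≡ rs l r (x i j) → α i j ≡ false → h p α ≡ h l α
  h-xˡ {l = l} {r} {α = α} eq e = trans (h-x eq α) (cong (λ c → if c then h r α else h l α) e)

  h-xʳ : ∀ {p l r i j α} → kind π p ≡ rs l r (x i j) → α i j ≡ true → h p α ≡ h r α
  h-xʳ {l = l} {r} {α = α} eq e = trans (h-x eq α) (cong (λ c → if c then h r α else h l α) e)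

  h-y : ∀ {p l r s k} → kind π p ≡ rs l r (y-var s k) → ∀ α →
        (h l α ≃ h r α) × (h p α ≡ h l α ⊙ h r α)
  h-y {s = true}  eq α with _ , _ , _ , _ , _ , _ , st ← valid-node eq
    with c , e ← proj₂ (st z refl) (s≤s (s≤s z≤n)) = c (environment α) , e (environment α)
  h-y {s = false} eq α with _ , _ , _ , _ , _ , _ , st ← valid-node eq
    with c , e ← proj₂ (st z refl) (s≤s (s≤s z≤n)) = c (environment α) , e (environment α)

  -- Unfolding into a tree; tracing literals and pivots

  -- Arguments about all paths below a line become structural inductions. The tree may be far larger
  -- than `π`, but the final count is of indices, not of tree nodes.
  data Tree (p : Index) : Set where
    leaf : kind π p ≡ ax → Tree p
    node : ∀ {l r v} → kind π p ≡ rs l r v → Tree l → Tree r → Tree p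

  tree : ∀ p → Tree p
  tree p = grow (<-wellFounded p)
    where
    grow : ∀ {p} → Acc Fin._<_ p → Tree p
    grow {p} (acc smaller) with kind π p in eq
    ... | ax       = leaf eq
    ... | rs l r v = node eq (grow (smaller (proj₁ (valid-node eq))))
                             (grow (smaller (proj₁ (proj₂ (valid-node eq)))))

  infix 4 _∈piv_ _∉piv_

  _∈piv_ _∉piv_ : CRVar n → ∀ {p} → Tree p → Set
  v ∈piv leaf _             = ⊥
  v ∈piv node {v = w} _ t u = v ≡ w ⊎ v ∈piv t ⊎ v ∈piv u
  v ∉piv t = ¬ (v ∈piv t)

  AnyLeaf : (Index → Set) → ∀ {p} → Tree p → Set
  AnyLeaf P {p} (leaf _) = P p
  AnyLeaf P (node _ t u) = AnyLeaf P t ⊎ AnyLeaf P u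

  anyLeaf-map : ∀ {P Q : Index → Set} → (∀ {q} → AxiomView q → P q → Q q) →
                ∀ {p} (t : Tree p) → AnyLeaf P t → AnyLeaf Q t
  anyLeaf-map f (leaf eq)    m        = f (axiom-at eq) m
  anyLeaf-map f (node _ t u) (inj₁ m) = inj₁ (anyLeaf-map f t m)
  anyLeaf-map f (node _ t u) (inj₂ m) = inj₂ (anyLeaf-map f u m)

  anyLeaf-∃ : ∀ {J : Set} {P : J → Index → Set} {p} (t : Tree p) →
              AnyLeaf (λ q → ∃ λ j → P j q) t → ∃ λ j → AnyLeaf (P j) t
  anyLeaf-∃ (leaf _)     m        = m
  anyLeaf-∃ (node _ t u) (inj₁ m) = Product.map₂ inj₁ (anyLeaf-∃ t m)
  anyLeaf-∃ (node _ t u) (inj₂ m) = Product.map₂ inj₂ (anyLeaf-∃ u m)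

  literal-origin : ∀ {m p} (t : Tree p) → m ∈ C p → AnyLeaf (λ q → m ∈ C q) t
  literal-origin (leaf _)      m∈ = m∈
  literal-origin (node eq t u) m∈ =
    Sum.map (literal-origin t) (literal-origin u) (Step.origin (step eq) m∈)

  -- On its way up from a leaf a literal can vanish only at a step whose pivot is its own variable.
  literal-fate : ∀ {m p} (t : Tree p) → AnyLeaf (λ q → m ∈ C q) t → m ∈ C p ⊎ proj₁ m ∈piv t
  literal-fate (leaf _) m∈ = inj₁ m∈
  literal-fate {m} (node {v = w} eq t u) (inj₁ below) with literal-fate t below | m ≟L (w , true)
  ... | inj₂ piv | _       = inj₂ (inj₂ (inj₁ piv))
  ... | inj₁ _   | yes m≡  = inj₂ (inj₁ (cong proj₁ m≡))
  ... | inj₁ m∈  | no m≢   = inj₁ (Step.fromˡ (step eq) m∈ m≢)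
  literal-fate {m} (node {v = w} eq t u) (inj₂ below) with literal-fate u below | m ≟L (w , false)
  ... | inj₂ piv | _       = inj₂ (inj₂ (inj₂ piv))
  ... | inj₁ _   | yes m≡  = inj₂ (inj₁ (cong proj₁ m≡))
  ... | inj₁ m∈  | no m≢   = inj₁ (Step.fromʳ (step eq) m∈ m≢)

  survives : ∀ {m p} (t : Tree p) → AnyLeaf (λ q → m ∈ C q) t → proj₁ m ∉piv t → m ∈ C p
  survives t below ∉piv with literal-fate t below
  ... | inj₁ m∈  = m∈
  ... | inj₂ piv = contradiction piv ∉piv

  -- The premises of a resolution step contain the pivot in both signs, and each of these literals
  -- traces back to an axiom.
  pivot-origin : ∀ {v p} (t : Tree p) → v ∈piv t → ∀ c → AnyLeaf (λ q → (v , c) ∈ C q) t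
  pivot-origin (node eq t u) (inj₁ refl)       true  = inj₁ (literal-origin t (Step.v∈l (step eq)))
  pivot-origin (node eq t u) (inj₁ refl)       false = inj₂ (literal-origin u (Step.v̄∈r (step eq)))
  pivot-origin (node eq t u) (inj₂ (inj₁ piv)) c     = inj₁ (pivot-origin t piv c)
  pivot-origin (node eq t u) (inj₂ (inj₂ piv)) c     = inj₂ (pivot-origin u piv c)

  -- With the next two lemmas, this reads the axiom off a single literal: an x-literal with its sign
  -- occurs in one A_ij or B_ij only, a positive y-literal only in short axioms, a negative one only
  -- in the long axiom of its side.
  xlit-short : ∀ {s i j q} → AxiomView q → xlit s i j ∈ C q → IsShort s i j q
  xlit-short (short t k l ex) m with IsShort.only ex m
  ... | inj₂ e = contradiction e xlit≢ylit
  ... | inj₁ e with refl , refl , refl ← xlit-injective e = ex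
  xlit-short (long t ex) m with _ , e ← IsLong.only ex m = contradiction (cong proj₁ e) x≢y

  ylit-short : ∀ {s i q} → AxiomView q → ylit s i ∈ C q → ∃ λ j → IsShort s i j q
  ylit-short (short t k l ex) m with IsShort.only ex m
  ... | inj₁ e = contradiction (sym (cong proj₁ e)) x≢y
  ... | inj₂ e with refl , refl ← y-var-injective (cong proj₁ e) = l , ex
  ylit-short (long t ex) m with _ , e ← IsLong.only ex m = contradiction (cong proj₂ e) λ ()

  nlit-long : ∀ {s i q} → AxiomView q → nlit s i ∈ C q → IsLong s q
  nlit-long (short t k l ex) m with IsShort.only ex m
  ... | inj₁ e = contradiction (sym (cong proj₁ e)) x≢y
  ... | inj₂ e = contradiction (cong proj₂ e) λ ()
  nlit-long (long t ex) m with _ , e ← IsLong.only ex m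
    with refl , refl ← y-var-injective (cong proj₁ e) = ex

  short-x∈ : ∀ {s i j p} (t : Tree p) → AnyLeaf (IsShort s i j) t → AnyLeaf (λ q → xlit s i j ∈ C q) t
  short-x∈ = anyLeaf-map (λ _ → IsShort.x∈)

  short-y∈ : ∀ {s i j p} (t : Tree p) → AnyLeaf (IsShort s i j) t → AnyLeaf (λ q → ylit s i ∈ C q) t
  short-y∈ = anyLeaf-map (λ _ → IsShort.y∈)

  long-y∈ : ∀ {s p} i (t : Tree p) → AnyLeaf (IsLong s) t → AnyLeaf (λ q → nlit s i ∈ C q) t
  long-y∈ i = anyLeaf-map (λ _ ex → IsLong.y∈ ex i)

  -- Regularity and freshness

  Regularᵗ : ∀ {p} → Tree p → Set
  Regularᵗ (leaf _)             = ⊤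
  Regularᵗ (node {v = v} _ t u) = v ∉piv t × v ∉piv u × Regularᵗ t × Regularᵗ u

  path : ∀ {p} → Tree p → ∃ (PathTo π p)
  path (leaf eq)     = [] , leaf eq
  path (node eq t u) = _ , viaL eq (proj₂ (path t))

  -- `Regular` speaks of complete paths, so the occurrence of a pivot has to be prolonged to a leaf
  -- before regularity applies.
  path-through : ∀ {v p} (t : Tree p) → v ∈piv t → ∃ λ ps → PathTo π p ps × v ∈ ps
  path-through (node eq t u) (inj₁ refl) = _ , viaL eq (proj₂ (path t)) , here refl
  path-through (node eq t u) (inj₂ (inj₁ piv)) with _ , to , v∈ ← path-through t piv =
    _ , viaL eq to , there v∈
  path-through (node eq t u) (inj₂ (inj₂ piv)) with _ , to , v∈ ← path-through u piv =
    _ , viaR eq to , there v∈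

  head-fresh : ∀ {v : CRVar n} {ps} → Unique (v ∷ ps) → v ∉ ps
  head-fresh (fresh ∷ _) v∈ = All.lookup fresh v∈ refl

  regular : ∀ {p} (t : Tree p) → (∀ ps → PathTo π p ps → Unique ps) → Regularᵗ t
  regular (leaf _)      _    = tt
  regular (node eq t u) uniq =
      (λ piv → let _ , to , v∈ = path-through t piv in head-fresh (uniq _ (viaL eq to)) v∈)
    , (λ piv → let _ , to , v∈ = path-through u piv in head-fresh (uniq _ (viaR eq to)) v∈)
    , regular t (λ ps to → AllPairs.tail (uniq _ (viaL eq to)))
    , regular u (λ ps to → AllPairs.tail (uniq _ (viaR eq to)))

  -- Every literal of a clause still has to be resolved on the way to the root,
  -- so by regularity its variable is no pivot further down.
  record Fresh {p} (t : Tree p) : Set where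
    field
      not-pivot     : ∀ {m} → m ∈ C p → proj₁ m ∉piv t
      non-tautology : ∀ {v} → (v , true) ∈ C p → (v , false) ∉ C p

  module _ {p l r v} {eq : kind π p ≡ rs l r v} {t : Tree l} {u : Tree r}
           (reg : Regularᵗ (node eq t u)) (fresh : Fresh (node eq t u)) where
    open Fresh fresh
    open Step (step eq)

    -- `IsResolvent` passes a pivot literal of the wrong sign on to the conclusion, where freshness
    -- bars its variable from being a pivot.
    v̄∉left : (v , false) ∉ C l
    v̄∉left m = not-pivot (fromˡ m λ ()) (inj₁ refl)

    v∉right : (v , true) ∉ C r
    v∉right m = not-pivot (fromʳ m λ ()) (inj₁ refl)

    -- Only `(v , true)` can be lost between `C l` and `C p`, and regularity keeps `v` from being a
    -- pivot in `t`; the other literals inherit freshness from the conclusion.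
    left-fresh : Fresh t
    left-fresh .Fresh.not-pivot {m} m∈ piv with m ≟L (v , true)
    ... | yes refl = proj₁ reg piv
    ... | no m≢    = not-pivot (fromˡ m∈ m≢) (inj₂ (inj₁ piv))
    left-fresh .Fresh.non-tautology {w} pos neg with w ≟CR v
    ... | yes refl = v̄∉left neg
    ... | no w≢    = non-tautology (fromˡ pos (w≢ ∘ cong proj₁)) (fromˡ neg (w≢ ∘ cong proj₁))

    right-fresh : Fresh u
    right-fresh .Fresh.not-pivot {m} m∈ piv with m ≟L (v , false)
    ... | yes refl = proj₁ (proj₂ reg) piv
    ... | no m≢    = not-pivot (fromʳ m∈ m≢) (inj₂ (inj₂ piv))
    right-fresh .Fresh.non-tautology {w} pos neg with w ≟CR v
    ... | yes refl = v∉right pos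
    ... | no w≢    = non-tautology (fromʳ pos (w≢ ∘ cong proj₁)) (fromʳ neg (w≢ ∘ cong proj₁))

  -- Merge functions: dependence, totality, attained values

  -- Axioms have constant strategies and y-pivots combine pointwise, so only x-pivots consult the
  -- assignment.
  h-depends : ∀ {α β p} (t : Tree p) → (∀ i j → x i j ∈piv t → α i j ≡ β i j) → h p α ≡ h p β
  h-depends {α} {β} (leaf eq) _ with axiom-at eq
  ... | short _ _ _ ex = trans (IsShort.h≡val ex α) (sym (IsShort.h≡val ex β))
  ... | long _ ex      = trans (IsLong.h≡⋆ ex α) (sym (IsLong.h≡⋆ ex β))
  h-depends {α} {β} (node {v = v} eq t u) agree with pivotView v (Step.existential (step eq))
  ... | is-x i j rewrite h-x eq α | h-x eq β | agree i j (inj₁ refl)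
                       | h-depends t (λ i j → agree i j ∘ inj₂ ∘ inj₁)
                       | h-depends u (λ i j → agree i j ∘ inj₂ ∘ inj₂) = refl
  ... | is-y s k = trans (proj₂ (h-y eq α))
    (trans (cong₂ _⊙_ (h-depends t (λ i j → agree i j ∘ inj₂ ∘ inj₁))
                      (h-depends u (λ i j → agree i j ∘ inj₂ ∘ inj₂)))
           (sym (proj₂ (h-y eq β))))

  h-depends-at : ∀ s {α β p} (t : Tree p) →
                 (∀ i j → x-var s i j ∈piv t → at s α i j ≡ at s β i j) → h p α ≡ h p β
  h-depends-at true  t agree = h-depends t agree
  h-depends-at false t agree = h-depends t (λ i j → agree j i)

  data NotNegated : CRVar n × Bool → Set where
    is-x     : ∀ {i j c} → NotNegated (x i j , c)
    positive : ∀ {v} → NotNegated (v , true)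

  nlit-negated : ∀ {s i} → ¬ NotNegated (nlit s i)
  nlit-negated {true}  ()
  nlit-negated {false} ()

  -- `⋆` enters only at L_A and L_B, which contain no such literal. Inner nodes always avoid it: an
  -- x-pivot puts an x-literal into both premises, and a y-pivot puts a positive literal into the
  -- left one, whose value `⊙` keeps.
  h-total : ∀ {m p} (t : Tree p) → m ∈ C p → NotNegated m → ∀ α → h p α ≢ ⋆
  h-total-node : ∀ {p l r v} (eq : kind π p ≡ rs l r v) → Tree l → Tree r → ∀ α → h p α ≢ ⋆

  h-total (leaf eq) m∈ nn α with axiom-at eq
  ... | short _ _ _ ex = λ e → val≢⋆ (trans (sym (IsShort.h≡val ex α)) e)
  ... | long _ ex with _ , refl ← IsLong.only ex m∈ = λ _ → nlit-negated nn
  h-total (node eq t u) _ _ = h-total-node eq t u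

  h-total-node {v = v} eq t u α with pivotView v (Step.existential (step eq))
  ... | is-x i j with α i j | h-x eq α
  ...   | true  | e = λ p≡⋆ → h-total u (Step.v̄∈r (step eq)) is-x α (trans (sym e) p≡⋆)
  ...   | false | e = λ p≡⋆ → h-total t (Step.v∈l (step eq)) is-x α (trans (sym e) p≡⋆)
  h-total-node eq t u α | is-y s k =
    λ p≡⋆ → ⊙≢⋆ (h-total t (Step.v∈l (step eq)) positive α) (trans (sym (proj₂ (h-y eq α))) p≡⋆)

  -- Set the x-pivots so as to steer towards the leaf. By regularity a pivot does not recur below,
  -- so setting it leaves the value chosen there intact. At y-pivots consistency makes the value
  -- survive `⊙` from either premise.
  h-attains : ∀ {s p} (t : Tree p) → Regularᵗ t →
              AnyLeaf (λ q → ∀ α → h q α ≡ val s) t → ∃ λ α → h p α ≡ val s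
  h-attains (leaf _) _ const = (λ _ _ → true) , const _
  h-attains (node {v = v} eq t u) (v∉t , v∉u , reg-t , reg-u) below
    with pivotView v (Step.existential (step eq)) | below
  ... | is-x i j | inj₁ m with α , e ← h-attains t reg-t m =
    set i j false α , trans (h-xˡ eq (set-same i j false α))
      (trans (h-depends {set i j false α} t (λ k l piv → set-other i j k l false α λ { refl → v∉t piv })) e)
  ... | is-x i j | inj₂ m with α , e ← h-attains u reg-u m =
    set i j true α , trans (h-xʳ eq (set-same i j true α))
      (trans (h-depends {set i j true α} u (λ k l piv → set-other i j k l true α λ { refl → v∉u piv })) e)
  ... | is-y s k | inj₁ m with α , e ← h-attains t reg-t m =
    α , trans (proj₂ (h-y eq α)) (⊙-valˡ e)
  ... | is-y s k | inj₂ m with α , e ← h-attains u reg-u m =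
    α , trans (proj₂ (h-y eq α)) (⊙-valʳ (proj₁ (h-y eq α)) e)

  short-val : ∀ {s i j p} (t : Tree p) → Regularᵗ t → AnyLeaf (IsShort s i j) t → ∃ λ α → h p α ≡ val s
  short-val t reg below = h-attains t reg (anyLeaf-map (λ _ → IsShort.h≡val) t below)

  x-pivot-short : ∀ {s i j p} (t : Tree p) → x-var s i j ∈piv t → AnyLeaf (IsShort s i j) t
  x-pivot-short {s} t piv = anyLeaf-map xlit-short t (pivot-origin t piv s)

  -- Below an x-pivot lie short axioms of both sides, and the one of side `not s` would make `h p`
  -- attain `val (not s)`.
  constant⇒no-x-pivot : ∀ {s p} (t : Tree p) → Regularᵗ t → (∀ α → h p α ≡ val s) →
                        ∀ i j → x-var s i j ∉piv t
  constant⇒no-x-pivot {s} t reg const i j piv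
    with α , e ← short-val t reg (x-pivot-short {not s} t (subst (_∈piv t) (x-var-swap s i j) piv)) =
    not-¬ refl (sym (val-injective {not s} {s} (trans (sym e) (const α))))

  -- The first pivot that is not an x-variable

  XOnly : Index → Set
  XOnly p = ∀ s k c → (y-var s k , c) ∉ C p

  module TopYPivot (other : (k : Fin n) → ∃ λ i → i ≢ k)
           {p l r s k} (eq : kind π p ≡ rs l r (y-var s k)) (t : Tree l) (u : Tree r)
           (reg : Regularᵗ (node eq t u)) (fresh : Fresh (node eq t u)) (x-only : XOnly p) where
    open Step (step eq)

    reg-l : Regularᵗ t
    reg-l = proj₁ (proj₂ (proj₂ reg))

    reg-r : Regularᵗ u
    reg-r = proj₂ (proj₂ (proj₂ reg))

    -- By regularity `y-var s k` is no pivot in `t`, so its negative literal from the long axiom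
    -- would reach `C l`.
    no-long-left : ¬ AnyLeaf (IsLong s) t
    no-long-left below = v̄∉left reg fresh (survives t (long-y∈ k t below) (proj₁ reg))

    long-right : AnyLeaf (IsLong s) u
    long-right = anyLeaf-map nlit-long u (literal-origin u v̄∈r)

    -- Such a pivot needs a negative literal, whose only source is the long axiom just excluded.
    no-y-pivot-left : ∀ i → y-var s i ∉piv t
    no-y-pivot-left i piv = no-long-left (anyLeaf-map nlit-long t (pivot-origin t piv false))

    short-left⇒y∈ : ∀ {i j} → AnyLeaf (IsShort s i j) t → ylit s i ∈ C l
    short-left⇒y∈ {i} below = survives t (short-y∈ t below) (no-y-pivot-left i)

    -- `y-var s i` is no pivot in `u`: by regularity if `i` is `k`, and otherwise because its
    -- literal passes from `C l` into `C p`, where freshness applies. So a short axiom in `u`,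
    -- together with the long one there, would make `C r` a tautology.
    y∈left⇒no-short-right : ∀ {i j} → ylit s i ∈ C l → ¬ AnyLeaf (IsShort s i j) u
    y∈left⇒no-short-right {i} y∈ below =
      Fresh.non-tautology (right-fresh reg fresh) (survives u (short-y∈ u below) ∉piv)
                                                  (survives u (long-y∈ i u long-right) ∉piv)
      where
      ∉piv : y-var s i ∉piv u
      ∉piv piv with ylit s i ≟L ylit s k
      ... | yes e = proj₁ (proj₂ reg) (subst (_∈piv u) (cong proj₁ e) piv)
      ... | no e  = Fresh.not-pivot fresh (fromˡ y∈ e) (inj₂ (inj₂ piv))

    h-right≢⋆ : ∀ α → h r α ≢ ⋆
    h-right≢⋆ = go u
      where
      go : Tree r → ∀ α → h r α ≢ ⋆
      go (node e t′ u′) = h-total-node e t′ u′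
      -- A leaf here is the long axiom itself; its negative literal at a second index would survive
      -- into `C p`, which has only x-literals.
      go (leaf e) with i , i≢k ← other k =
        contradiction (fromʳ (IsLong.y∈ (nlit-long (axiom-at e) v̄∈r) i)
                             (i≢k ∘ proj₂ ∘ y-var-injective ∘ cong proj₁))
                      (x-only s i false)

    h-left≡right : ∀ α → h l α ≡ h r α
    h-left≡right α with proj₁ (h-y eq α)
    ... | inj₁ l≡⋆        = contradiction l≡⋆ (h-total t v∈l positive α)
    ... | inj₂ (inj₁ r≡⋆) = contradiction r≡⋆ (h-right≢⋆ α)
    ... | inj₂ (inj₂ e)   = e

    -- h l only depends on the rows i (columns, if s = false) with ylit s i ∈ C l,
    -- and h r only on the others.
    h-left-constant : ∀ α β → h l α ≡ h l β
    h-left-constant α β = begin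
      h l α ≡⟨ h-left≡right α ⟩
      h r α ≡⟨ h-depends-at s u (λ i j piv → sym (outside i j λ y∈ →
                 y∈left⇒no-short-right y∈ (x-pivot-short u piv))) ⟩
      h r γ ≡⟨ h-left≡right γ ⟨
      h l γ ≡⟨ h-depends-at s t (λ i j piv → inside i j (short-left⇒y∈ (x-pivot-short t piv))) ⟩
      h l β ∎
      where
      open ≡-Reasoning
      γ : Assignment n
      γ = at s (λ i j → if does (ylit s i ∈? C l) then at s β i j else at s α i j)
      inside : ∀ i j → ylit s i ∈ C l → at s γ i j ≡ at s β i j
      inside i j y∈ = trans (at-involutive s _ i j)
        (cong (if_then at s β i j else at s α i j) (dec-true (ylit s i ∈? C l) y∈))
      outside : ∀ i j → ylit s i ∉ C l → at s γ i j ≡ at s α i j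
      outside i j y∉ = trans (at-involutive s _ i j)
        (cong (if_then at s β i j else at s α i j) (dec-false (ylit s i ∈? C l) y∉))

    -- The positive pivot literal in `C l` stems from a short axiom of side `s`, so the constant
    -- value of `h l` must be the one of that axiom.
    h-left≡val : ∀ α → h l α ≡ val s
    h-left≡val α
      with _ , below ← anyLeaf-∃ t (anyLeaf-map ylit-short t (literal-origin t v∈l))
      with β , e ← short-val t reg-l below = trans (h-left-constant α β) e

    h-right≡val : ∀ α → h r α ≡ val s
    h-right≡val α = trans (sym (h-left≡right α)) (h-left≡val α)

    -- Allows the side to be recovered from the line alone when counting.
    h≡val : ∀ α → h p α ≡ val s
    h≡val α = trans (proj₂ (h-y eq α)) (⊙-valˡ (h-left≡val α))

    -- For `k` a short axiom lies below the left premise. For any other `i`, the negative literal of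
    -- the long axiom in `u` must be resolved away, which needs a short axiom of `i` in `u`. As both
    -- merge functions are constantly `val s`, no x-pivot removes the x-literal of that axiom.
    spans : ∀ i → ∃ λ j → xlit s i j ∈ C p
    spans i with y-var s i ≟CR y-var s k
    ... | yes e with refl ← proj₂ (y-var-injective e)
                with j , below ← anyLeaf-∃ t (anyLeaf-map ylit-short t (literal-origin t v∈l)) =
      j , fromˡ (survives t (short-x∈ t below) (constant⇒no-x-pivot t reg-l h-left≡val k j)) xlit≢ylit
    ... | no i≢k with literal-fate u (long-y∈ i u long-right)
    ...   | inj₁ y∈  = contradiction (fromʳ y∈ (i≢k ∘ cong proj₁)) (x-only s i false)
    ...   | inj₂ piv with j , below ← anyLeaf-∃ u (anyLeaf-map ylit-short u (pivot-origin u piv true)) =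
      j , fromʳ (survives u (short-x∈ u below) (constant⇒no-x-pivot u reg-r h-right≡val i j))
                (x≢y ∘ cong proj₁)

  -- Following an assignment from the root

  Falsified : Assignment n → Index → Set
  Falsified α p = ∀ i j c → (x i j , c) ∈ C p → α i j ≡ not c

  record Spanning (α : Assignment n) : Set where
    field
      index     : Index
      side      : Bool
      falsified : Falsified α index
      spans     : ∀ i → ∃ λ j → xlit side i j ∈ C index
      h≡val     : ∀ β → h index β ≡ val side

  -- At an x-pivot, moving to the premise whose pivot literal `α` falsifies preserves all
  -- invariants. Every axiom contains a y-literal, so a y-pivot is met before any leaf.
  descend : (∀ k → ∃ λ i → i ≢ k) → Fin n → ∀ α {p} (t : Tree p) →
            Regularᵗ t → Fresh t → XOnly p → Falsified α p → Spanning α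
  descend other k α (leaf eq) _ _ x-only fals with axiom-at eq
  ... | short s i j ex = contradiction (IsShort.y∈ ex) (x-only s i true)
  ... | long s ex      = contradiction (IsLong.y∈ ex k) (x-only s k false)
  descend other k α {p} (node {l} {r} {v} eq t u) reg fresh x-only fals
    with pivotView v (Step.existential (step eq))
  ... | is-y s i = record { index = p ; side = s ; falsified = fals ; spans = L.spans ; h≡val = L.h≡val }
    where module L = TopYPivot other eq t u reg fresh x-only
  ... | is-x i j with α i j in αij
  ...   | false = descend other k α t (proj₁ (proj₂ (proj₂ reg))) (left-fresh reg fresh)
    (λ s i c m → x-only s i c (fromˡ m (x≢y {s = true} ∘ sym ∘ cong proj₁))) fals-l
    where
    open Step (step eq)
    fals-l : Falsified α l
    fals-l i′ j′ c m with (x i′ j′ , c) ≟L (x i j , true)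
    ... | yes refl = αij
    ... | no ne    = fals i′ j′ c (fromˡ m ne)
  ...   | true = descend other k α u (proj₂ (proj₂ (proj₂ reg))) (right-fresh reg fresh)
    (λ s i c m → x-only s i c (fromʳ m (x≢y {s = true} ∘ sym ∘ cong proj₁))) fals-r
    where
    open Step (step eq)
    fals-r : Falsified α r
    fals-r i′ j′ c m with (x i′ j′ , c) ≟L (x i j , false)
    ... | yes refl = αij
    ... | no ne    = fals i′ j′ c (fromʳ m ne)

-- Counting lines by test assignments

Fin-other : ∀ {m} (k : Fin (suc (suc m))) → ∃ λ i → i ≢ k
Fin-other zero    = suc zero , λ ()
Fin-other (suc k) = zero , λ ()

agree : Fin 2 → Fin 2 → Bool
agree f g = does (f Fin.≟ g)

agree-comm : ∀ f g → agree f g ≡ agree g f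
agree-comm zero       zero       = refl
agree-comm zero       (suc zero) = refl
agree-comm (suc zero) zero       = refl
agree-comm (suc zero) (suc zero) = refl

-- Holds because there are two letters: differing from `w` also determines a letter.
agree-cancelʳ : ∀ f g w → agree f w ≡ agree g w → f ≡ g
agree-cancelʳ zero       zero       _          _  = refl
agree-cancelʳ (suc zero) (suc zero) _          _  = refl
agree-cancelʳ zero       (suc zero) zero       ()
agree-cancelʳ zero       (suc zero) (suc zero) ()
agree-cancelʳ (suc zero) zero       zero       ()
agree-cancelʳ (suc zero) zero       (suc zero) ()

finToFun-injective : ∀ {m} n {c d : Fin (m ^ n)} → finToFun {m} {n} c ≗ finToFun {m} {n} d → c ≡ d
finToFun-injective     zero    {zero} {zero} _  = refl
finToFun-injective {m} (suc n) {c}    {d}    eq = begin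
  c                                    ≡⟨ combine-remQuot {m} (m ^ n) c ⟨
  uncurry combine (remQuot {m} (m ^ n) c)
    ≡⟨ cong₂ (combine {m} {m ^ n}) (eq zero) (finToFun-injective {m} n (eq ∘ suc)) ⟩
  uncurry combine (remQuot {m} (m ^ n) d) ≡⟨ combine-remQuot {m} (m ^ n) d ⟩
  d                                    ∎
  where open ≡-Reasoning

remQuot-injective : ∀ {m} n {c d : Fin (m * n)} → remQuot {m} n c ≡ remQuot {m} n d → c ≡ d
remQuot-injective {m} n {c} {d} eq =
  trans (sym (combine-remQuot {m} n c)) (trans (cong (uncurry combine) eq) (combine-remQuot {m} n d))

module Test (n : ℕ) where

  Word : Set
  Word = Fin (2 ^ n)

  letter : Word → Fin n → Fin 2
  letter = finToFun {2} {n}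

  select : Word × Word → Bool → Word
  select (u , w) true  = u
  select (u , w) false = w

  select-ext : ∀ {c d} s → select c s ≡ select d s → select c (not s) ≡ select d (not s) → c ≡ d
  select-ext true  e e′ = cong₂ _,_ e e′
  select-ext false e e′ = cong₂ _,_ e′ e

  test : Word × Word → Assignment n
  test (u , w) i j = agree (letter u i) (letter w j)

  at-test : ∀ s c i j → at s (test c) i j ≡ agree (letter (select c s) i) (letter (select c (not s)) j)
  at-test true  _       i j = refl
  at-test false (u , w) i j = agree-comm (letter u j) (letter w i)

size-bound : ∀ {m} (R : Representation) (ρ : MRes.Refutation (CR (suc (suc m))) R) →
             MRes.Regular (CR (suc (suc m))) R ρ → 2 ^ suc (suc m) ≤ MRes.refSize (CR (suc (suc m))) R ρ
size-bound {m} R ρ is-regular =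
  *-cancelʳ-≤ _ _ (2 ^ n) {{m^n≢0 2 n}} (injective⇒≤ {f = encode} encode-injective)
  where
  n : ℕ
  n = suc (suc m)

  open MRes (CR n) R
  open Unfolding R (deriv ρ)
  open Test n
  open Spanning

  no-literal : ∀ {m} → m ∉ C (root (deriv ρ))
  no-literal m∈ with () ← subst (_ ∈_) (empty ρ) m∈

  spanning : ∀ α → Spanning α
  spanning α = descend Fin-other zero α t (regular t is-regular)
    (record { not-pivot     = λ m∈ → contradiction m∈ no-literal
            ; non-tautology = λ m∈ → contradiction m∈ no-literal })
    (λ _ _ _ → no-literal)
    (λ _ _ _ m∈ → contradiction m∈ no-literal)
    where
    t : Tree (root (deriv ρ))
    t = tree (root (deriv ρ))

  falsified-at : ∀ {α p} → Falsified α p → ∀ s i j → xlit s i j ∈ C p → at s α i j ≡ not s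
  falsified-at fals true  i j = fals i j true
  falsified-at fals false i j = fals j i false

  -- In each row the line has a literal falsified by both tests, which fixes whether the unknown
  -- letter agrees with a known letter of the shared word.
  determined : ∀ {p} s c d → Falsified (test c) p → Falsified (test d) p →
               (∀ i → ∃ λ j → xlit s i j ∈ C p) →
               select c (not s) ≡ select d (not s) → select c s ≡ select d s
  determined s c d fals-c fals-d spans-p e = finToFun-injective n same-letter
    where
    same-letter : ∀ i → letter (select c s) i ≡ letter (select d s) i
    same-letter i with j , x∈ ← spans-p i =
      agree-cancelʳ _ _ (letter (select c (not s)) j) (begin
        agree (letter (select c s) i) (letter (select c (not s)) j) ≡⟨ at-test s c i j ⟨
        at s (test c) i j                                           ≡⟨ falsified-at fals-c s i j x∈ ⟩
        not s                                                       ≡⟨ falsified-at fals-d s i j x∈ ⟨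
        at s (test d) i j                                           ≡⟨ at-test s d i j ⟩
        agree (letter (select d s) i) (letter (select d (not s)) j)
          ≡⟨ cong (λ w → agree (letter (select d s) i) (letter w j)) e ⟨
        agree (letter (select d s) i) (letter (select c (not s)) j) ∎)
      where open ≡-Reasoning

  key : ∀ c → Spanning (test c) → Index × Word
  key c S = index S , select c (not (side S))

  key-injective : ∀ c d (S : Spanning (test c)) (T : Spanning (test d)) → key c S ≡ key d T → c ≡ d
  key-injective c d record { side = s ; falsified = fals-c ; spans = spans-p ; h≡val = hs }
                    record { side = t ; falsified = fals-d ; h≡val = ht } e
    with refl ← cong proj₁ e
    -- The key omits the side, but the line's constant `h` reveals it; it is evaluated at an
    -- arbitrary assignment.
    with refl ← val-injective {s} {t} (trans (sym (hs λ _ _ → true)) (ht λ _ _ → true)) =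
    select-ext s (determined s c d fals-c fals-d spans-p (cong proj₂ e)) (cong proj₂ e)

  encode : Fin (2 ^ n * 2 ^ n) → Fin (size (deriv ρ) * 2 ^ n)
  encode c = uncurry combine (key (remQuot (2 ^ n) c) (spanning _))

  encode-injective : Injective _≡_ _≡_ encode
  encode-injective {c} {d} e = remQuot-injective {2 ^ n} (2 ^ n)
    (key-injective _ _ (spanning _) (spanning _)
      (uncurry (cong₂ _,_) (combine-injective _ _ _ _ e)))

theorem16 : (R : Representation) → Complete R →
    ∃[ d ] ∃[ n₀ ] ∀ n → n₀ ≤ n →
    (ρ : MRes.Refutation (CR n) R) → MRes.Regular (CR n) R ρ →
    2 ^ (n / suc d) ≤ MRes.refSize (CR n) R ρ
-- The bound is the full 2ⁿ, hence the divisor 1; the threshold 2 provides the second index for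
-- `Fin-other`.
theorem16 R _ = 0 , 2 , bound
  where
  bound : ∀ n → 2 ≤ n → (ρ : MRes.Refutation (CR n) R) → MRes.Regular (CR n) R ρ →
          2 ^ (n / 1) ≤ MRes.refSize (CR n) R ρ
  bound n (s≤s (s≤s _)) ρ is-regular =
    subst (λ k → 2 ^ k ≤ MRes.refSize (CR n) R ρ) (sym (n/1≡n n)) (size-bound R ρ is-regular)
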